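{- Let $\alpha,\beta,\gamma$ be complex numbers and let $n\ge 0$ be an integer. Put $W_n=\sum_{j=0}^nS(n,j;\alpha,\beta,\gamma)$. Then $$W_n=\sum_{k=0}^n(-1)^n\left[\sum_{j=0}^nL(k,j;\alpha,\beta,\gamma)\right]S(n,k;\alpha,\beta,\gamma),$$ where $S(n,k;\alpha,\beta,\gamma)$ are the (Hsu--Shiue) unified generalized Stirling numbers and $L(k,j;\alpha,\beta,\gamma)$ are the generalized Lah-type numbers.
   Context: For a number $\theta$ let $(t|\theta)_n=\prod_{i=0}^{n-1}(t-i\theta)$, with $(t|\theta)_0=1$. The numbers $S(n,k;\alpha,\beta,\gamma)$, $0\le k\le n$, are defined by the polynomial identity in $t$ $$(t|\alpha)_n=\sum_{k=0}^nS(n,k;\alpha,\beta,\gamma)\,(t-\gamma|\beta)_k .$$ Write $S^1(n,k)=S(n,k;\alpha,\beta,\gamma)$ and $S^2(n,k)=S(n,k;\beta,\alpha,-\gamma)$, so that $(t|\beta)_n=\sum_{k=0}^nS^2(n,k)(t+\gamma|\alpha)_k$. The generalized Lah-type numbers are defined by $$L(n,j;\alpha,\beta,\gamma)=\sum_{k=j}^n(-1)^kS^2(n,k)S^1(k,j),$$ with $L(n,j;\alpha,\beta,\gamma)=0$ for $j>n$ (empty sum). -}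

module Defs where

open import Level using (Level; _⊔_)
open import Algebra.Bundles using (CommutativeRing; RawMonoid)
open import Data.Fin.Base using (toℕ)
open import Data.List.Base using (List; []; _∷_; map)
open import Data.Nat.Base as ℕ using (ℕ; zero; suc; _∸_; _<_; s<s⁻¹)
open import Data.Nat.Properties using (≤-refl; m<n⇒m<1+n)
import Algebra.Definitions.RawMonoid as RawMonoidDefs
import Algebra.Properties.CommutativeSemigroup as CommutativeSemigroupProperties
import Algebra.Properties.Ring as RingProperties
import Algebra.Properties.Semiring.Exp as Exp
import Relation.Binary.Reasoning.Setoid as SetoidReasoning

module Range {c ℓ : Level} (M : RawMonoid c ℓ) where
  open RawMonoid M using (Carrier)

  -- f a + f (a + 1) + ⋯ + f b; there are (1 + b) ∸ a terms, so the sum is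
  -- empty when b < a.
  sumFromTo : ℕ → ℕ → (ℕ → Carrier) → Carrier
  sumFromTo a b f = RawMonoidDefs.sum M {suc b ∸ a} (λ i → f (a ℕ.+ toℕ i))

module Over {c ℓ : Level} (R : CommutativeRing c ℓ) where
  open CommutativeRing R
  open RawMonoidDefs +-rawMonoid using (_×_)

  infix 1 ∑
  ∑ : ℕ → ℕ → (ℕ → Carrier) → Carrier
  ∑ = Range.sumFromTo +-rawMonoid

  syntax ∑ a b (λ k → e) = ∑[ k from a to b ] e

  sgn : ℕ → Carrier
  sgn n = (- 1#) ^ n
    where open Exp semiring using (_^_)

  -- Polynomials in one indeterminate t over R: the list a₀ ∷ a₁ ∷ ⋯ stands
  -- for a₀ + a₁ t + ⋯.  Trailing zeros are allowed, so equality of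
  -- polynomials is equality of all coefficients.
  Poly : Set c
  Poly = List Carrier

  coeff : Poly → ℕ → Carrier
  coeff []      _       = 0#
  coeff (a ∷ p) zero    = a
  coeff (a ∷ p) (suc i) = coeff p i

  infix  4 _≈ₚ_
  infixl 6 _+ₚ_ _-ₚ_
  infixl 7 _*ₚ_
  infixr 7 _·ₚ_

  _≈ₚ_ : Poly → Poly → Set ℓ
  p ≈ₚ q = ∀ i → coeff p i ≈ coeff q i

  const : Carrier → Poly
  const a = a ∷ []

  indet : Poly
  indet = 0# ∷ 1# ∷ []

  _+ₚ_ : Poly → Poly → Poly
  []      +ₚ q       = q
  (a ∷ p) +ₚ []      = a ∷ p
  (a ∷ p) +ₚ (b ∷ q) = (a + b) ∷ (p +ₚ q)

  _·ₚ_ : Carrier → Poly → Poly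
  a ·ₚ p = map (a *_) p

  _-ₚ_ : Poly → Poly → Poly
  p -ₚ q = p +ₚ map -_ q

  _*ₚ_ : Poly → Poly → Poly
  []      *ₚ q = []
  (a ∷ p) *ₚ q = a ·ₚ q +ₚ (0# ∷ p *ₚ q)

  +ₚ-rawMonoid : RawMonoid c ℓ
  +ₚ-rawMonoid = record { Carrier = Poly ; _≈_ = _≈ₚ_ ; _∙_ = _+ₚ_ ; ε = [] }

  infix 1 ∑ₚ
  ∑ₚ : ℕ → ℕ → (ℕ → Poly) → Poly
  ∑ₚ = Range.sumFromTo +ₚ-rawMonoid

  syntax ∑ₚ a b (λ k → p) = ∑ₚ[ k from a to b ] p

  -- ⟨ p ∣ θ ⟩ n = p (p - θ) (p - 2θ) ⋯ (p - (n - 1)θ)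
  ⟨_∣_⟩ : Poly → Carrier → ℕ → Poly
  ⟨ p ∣ θ ⟩ zero    = const 1#
  ⟨ p ∣ θ ⟩ (suc n) = ⟨ p ∣ θ ⟩ n *ₚ (p -ₚ const (n × θ))

  -- S n k α β γ is S(n,k;α,β,γ).  It is pinned down only for k ≤ n: its
  -- values for k > n are arbitrary.
  record GeneralizedStirling : Set (c ⊔ ℓ) where
    field
      S        : ℕ → ℕ → Carrier → Carrier → Carrier → Carrier
      defining : ∀ α β γ n →
        ⟨ indet ∣ α ⟩ n
          ≈ₚ (∑ₚ[ k from 0 to n ] S n k α β γ ·ₚ ⟨ indet -ₚ const γ ∣ β ⟩ k)

    L : ℕ → ℕ → Carrier → Carrier → Carrier → Carrier
    L n j α β γ = ∑[ k from j to n ] sgn k * S n k β α (- γ) * S k j α β γ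

-- Over every R the numbers exist, so that quantifying over
-- GeneralizedStirling is never vacuous.  The witness T is given by
--   T (n + 1) k = T n (k - 1) + (γ + k β - n α) T n k.
module Existence {c ℓ : Level} (R : CommutativeRing c ℓ) where
  open CommutativeRing R
  open Over R
  open RawMonoidDefs +-rawMonoid using (_×_; sum)
  open SetoidReasoning setoid
  open CommutativeSemigroupProperties +-commutativeSemigroup using (interchange; x∙yz≈y∙xz)
  open RingProperties ring using (-‿distribʳ-*; -0#≈0#; -‿+-comm)

  coeff-+ : ∀ p q i → coeff (p +ₚ q) i ≈ coeff p i + coeff q i
  coeff-+ [] q i = sym (+-identityˡ _)
  coeff-+ (a ∷ p) [] i = sym (+-identityʳ _)
  coeff-+ (a ∷ p) (b ∷ q) zero = refl
  coeff-+ (a ∷ p) (b ∷ q) (suc i) = coeff-+ p q i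

  coeff-· : ∀ a p i → coeff (a ·ₚ p) i ≈ a * coeff p i
  coeff-· a [] i = sym (zeroʳ a)
  coeff-· a (b ∷ p) zero = refl
  coeff-· a (b ∷ p) (suc i) = coeff-· a p i

  mulLin : ∀ p b i → coeff (p *ₚ (b ∷ 1# ∷ [])) i ≈ coeff p i * b + coeff (0# ∷ p) i
  mulLin [] b zero = sym (trans (+-identityʳ _) (zeroˡ _))
  mulLin [] b (suc i) = sym (trans (+-identityʳ _) (zeroˡ _))
  mulLin (a ∷ p) b zero = refl
  mulLin (a ∷ p) b (suc zero) = begin
    coeff ((a * 1# ∷ []) +ₚ (p *ₚ _)) 0 ≈⟨ coeff-+ (a * 1# ∷ []) (p *ₚ _) 0 ⟩
    a * 1# + coeff (p *ₚ _) 0 ≈⟨ +-cong (*-identityʳ a) (trans (mulLin p b 0) (+-identityʳ _)) ⟩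
    a + coeff p 0 * b ≈⟨ +-comm _ _ ⟩
    coeff p 0 * b + a ∎
  mulLin (a ∷ p) b (suc (suc i)) = begin
    coeff ((a * 1# ∷ []) +ₚ (p *ₚ _)) (suc i) ≈⟨ coeff-+ (a * 1# ∷ []) (p *ₚ _) (suc i) ⟩
    0# + coeff (p *ₚ _) (suc i) ≈⟨ +-identityˡ _ ⟩
    coeff (p *ₚ _) (suc i) ≈⟨ mulLin p b (suc i) ⟩
    _ ∎

  Sm : ℕ → (ℕ → Carrier) → Carrier
  Sm n f = sum {n} (λ i → f (toℕ i))

  Sm-cong : ∀ n {f g} → (∀ k → f k ≈ g k) → Sm n f ≈ Sm n g
  Sm-cong zero h = refl
  Sm-cong (suc n) h = +-cong (h 0) (Sm-cong n (λ k → h (suc k)))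

  Sm-+ : ∀ n f g → Sm n f + Sm n g ≈ Sm n (λ k → f k + g k)
  Sm-+ zero f g = +-identityʳ _
  Sm-+ (suc n) f g = trans (interchange _ _ _ _) (+-congˡ (Sm-+ n (λ k → f (suc k)) (λ k → g (suc k))))

  Sm-* : ∀ n f b → Sm n f * b ≈ Sm n (λ k → f k * b)
  Sm-* zero f b = zeroˡ b
  Sm-* (suc n) f b = trans (distribʳ _ _ _) (+-congˡ (Sm-* n (λ k → f (suc k)) b))

  Sm-0 : ∀ n → Sm n (λ _ → 0#) ≈ 0#
  Sm-0 zero = refl
  Sm-0 (suc n) = trans (+-identityˡ _) (Sm-0 n)

  Sm-last : ∀ n f → Sm (suc n) f ≈ Sm n f + f n
  Sm-last zero f = +-comm _ _
  Sm-last (suc n) f = trans (+-congˡ (Sm-last n (λ k → f (suc k)))) (sym (+-assoc _ _ _))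

  coeff-Σ : ∀ n (s : ℕ → Carrier) (f : ℕ → Poly) i →
    coeff (RawMonoidDefs.sum +ₚ-rawMonoid {n} (λ k → s (toℕ k) ·ₚ f (toℕ k))) i ≈ Sm n (λ k → s k * coeff (f k) i)
  coeff-Σ zero s f i = refl
  coeff-Σ (suc n) s f i = trans (coeff-+ (s 0 ·ₚ f 0) _ i) (+-cong (coeff-· _ (f 0) i) (coeff-Σ n (λ k → s (suc k)) (λ k → f (suc k)) i))

  module _ (α β γ : Carrier) where
    e : ℕ → ℕ → Carrier
    e n k = γ + k × β - n × α

    T : ℕ → ℕ → Carrier
    T zero zero = 1#
    T zero (suc k) = 0#
    T (suc n) zero = T n 0 * e n 0
    T (suc n) (suc k) = T n k + T n (suc k) * e n (suc k)

    T0 : ∀ n k → n < k → T n k ≈ 0#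
    T0 zero (suc k) _ = refl
    T0 (suc n) (suc k) h = trans (+-cong (T0 n k (s<s⁻¹ h)) (trans (*-congʳ (T0 n (suc k) (m<n⇒m<1+n (s<s⁻¹ h)))) (zeroˡ _))) (+-identityʳ _)

    B : ℕ → Poly
    B = ⟨ indet -ₚ const γ ∣ β ⟩

    A : ℕ → Poly
    A = ⟨ indet ∣ α ⟩

    linval : ∀ γ d → (0# + - γ) + - d ≈ - (γ + d)
    linval γ d = trans (+-congʳ (+-identityˡ _)) (-‿+-comm γ d)

    shB : ∀ k i → coeff (0# ∷ B k) i ≈ coeff (B (suc k)) i + coeff (B k) i * (γ + k × β)
    shB k i = sym (begin
      coeff (B (suc k)) i + x * y ≈⟨ +-congʳ (mulLin (B k) _ i) ⟩
      (x * _ + z) + x * y ≈⟨ +-congʳ (+-congʳ (trans (*-congˡ (linval γ (k × β))) (sym (-‿distribʳ-* x y)))) ⟩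
      (- (x * y) + z) + x * y ≈⟨ +-congʳ (+-comm _ _) ⟩
      (z + - (x * y)) + x * y ≈⟨ +-assoc _ _ _ ⟩
      z + (- (x * y) + x * y) ≈⟨ +-congˡ (-‿inverseˡ _) ⟩
      z + 0# ≈⟨ +-identityʳ _ ⟩
      z ∎)
      where x = coeff (B k) i
            y = γ + k × β
            z = coeff (0# ∷ B k) i

    ex : ∀ n i → coeff (A n) i ≈ Sm (suc n) (λ k → T n k * coeff (B k) i)
    sh : ∀ n i → coeff (0# ∷ A n) i ≈ Sm (suc n) (λ k → T n k * coeff (0# ∷ B k) i)
    sh n zero = sym (trans (Sm-cong (suc n) {g = λ _ → 0#} (λ k → zeroʳ (T n k))) (Sm-0 (suc n)))
    sh n (suc i) = ex n i
    ex zero i = sym (trans (+-identityʳ _) (*-identityˡ _))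
    ex (suc n) i = begin
      coeff (A (suc n)) i ≈⟨ mulLin (A n) _ i ⟩
      coeff (A n) i * (0# + - (n × α)) + coeff (0# ∷ A n) i
        ≈⟨ +-cong (trans (*-cong (ex n i) (+-identityˡ _)) (Sm-* (suc n) (λ k → T n k * b k) _)) (sh n i) ⟩
      Sm (suc n) (λ k → T n k * b k * - (n × α)) + Sm (suc n) (λ k → T n k * coeff (0# ∷ B k) i)
        ≈⟨ Sm-+ (suc n) (λ k → T n k * b k * - (n × α)) (λ k → T n k * coeff (0# ∷ B k) i) ⟩
      Sm (suc n) (λ k → T n k * b k * - (n × α) + T n k * coeff (0# ∷ B k) i)
        ≈⟨ Sm-cong (suc n) term ⟩
      Sm (suc n) (λ k → T n k * b (suc k) + T n k * e n k * b k)
        ≈⟨ Sm-+ (suc n) (λ k → T n k * b (suc k)) g ⟨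
      Sm (suc n) (λ k → T n k * b (suc k)) + Sm (suc n) g
        ≈⟨ +-congˡ (trans (Sm-last (suc n) g) (trans (+-congˡ (trans (*-congʳ (trans (*-congʳ (T0 n (suc n) ≤-refl)) (zeroˡ _))) (zeroˡ _))) (+-identityʳ _))) ⟨
      Sm (suc n) (λ k → T n k * b (suc k)) + (g 0 + Sm (suc n) (λ k → g (suc k)))
        ≈⟨ x∙yz≈y∙xz _ _ _ ⟩
      g 0 + (Sm (suc n) (λ k → T n k * b (suc k)) + Sm (suc n) (λ k → g (suc k)))
        ≈⟨ +-congˡ (Sm-+ (suc n) (λ k → T n k * b (suc k)) (λ k → g (suc k))) ⟩
      g 0 + Sm (suc n) (λ k → T n k * b (suc k) + g (suc k))
        ≈⟨ +-congˡ (Sm-cong (suc n) (λ k → sym (distribʳ (b (suc k)) (T n k) (T n (suc k) * e n (suc k))))) ⟩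
      _ ∎
      where
      b : ℕ → Carrier
      b k = coeff (B k) i
      g : ℕ → Carrier
      g k = T n k * e n k * b k
      term : ∀ k → T n k * b k * - (n × α) + T n k * coeff (0# ∷ B k) i ≈ T n k * b (suc k) + T n k * e n k * b k
      term k = begin
        t * x * m + t * coeff (0# ∷ B k) i ≈⟨ +-cong (*-assoc _ _ _) (*-congˡ (shB k i)) ⟩
        t * (x * m) + t * (b (suc k) + x * y) ≈⟨ +-congˡ (distribˡ _ _ _) ⟩
        t * (x * m) + (t * b (suc k) + t * (x * y)) ≈⟨ x∙yz≈y∙xz _ _ _ ⟩
        t * b (suc k) + (t * (x * m) + t * (x * y)) ≈⟨ +-congˡ (trans (sym (distribˡ _ _ _)) (*-congˡ (sym (distribˡ _ _ _)))) ⟩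
        t * b (suc k) + t * (x * (m + y)) ≈⟨ +-congˡ (*-congˡ (trans (*-comm _ _) (*-congʳ (+-comm _ _)))) ⟩
        t * b (suc k) + t * ((y + m) * x) ≈⟨ +-congˡ (sym (*-assoc _ _ _)) ⟩
        t * b (suc k) + t * e n k * x ∎
        where t = T n k
              x = b k
              m = - (n × α)
              y = γ + k × β

  generalizedStirling : GeneralizedStirling
  generalizedStirling = record { S = λ n k α β γ → T α β γ n k
    ; defining = λ α β γ n i → trans (ex α β γ n i) (sym (coeff-Σ (suc n) (T α β γ n) (B α β γ) i)) }

{-# OPTIONS --safe #-}

-- S¹ and S² are mutually inverse lower triangular matrices, so L = S² D S¹
-- with D = diag ((-1)ᵏ) gives S¹ L = D S¹, whose n-th row sum is (-1)ⁿ Wₙ.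
-- Monicity of the (t - γ ∣ β)ₖ identifies S¹ with the solution T¹ of
--   T¹ (n + 1) k = T¹ n (k - 1) + (γ + k β - n α) T¹ n k,
-- and likewise S² with T².  The inverse relation then follows by induction from
-- the two recurrences, because their coefficients at (n , k) and (k , m) add up
-- to (m - n) α, which vanishes for m = n.
module Submission where

open import Defs
open import Level using (Level)
open import Algebra.Bundles using (CommutativeRing)
open import Data.Fin.Properties using (toℕ<n)
open import Data.Nat.Base as ℕ
  using (ℕ; zero; suc; _∸_; _<_; _≤_; z≤n; s≤s; z<s; s<s; s≤s⁻¹; s<s⁻¹)
open import Data.Nat.Properties using (≤-refl; m<n⇒m<1+n; m<1+n⇒m<n∨m≡n; m≤m+n)
open import Data.Sum.Base using (inj₁; inj₂)
import Relation.Binary.PropositionalEquality as ≡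
import Algebra.Definitions.RawMonoid as RawMonoidDefs
import Algebra.Properties.AbelianGroup as AbelianGroupProperties
import Algebra.Properties.Ring as RingProperties
import Algebra.Properties.Semiring.Sum as SemiringSum
import Algebra.Solver.Ring.NaturalCoefficients.Default as SemiringSolver
import Relation.Binary.Reasoning.Setoid as SetoidReasoning

i<n∸m⇒m+i<n : ∀ m {n i} → i < n ∸ m → m ℕ.+ i < n
i<n∸m⇒m+i<n zero            i<n   = i<n
i<n∸m⇒m+i<n (suc m) {suc n} i<n∸m = s<s (i<n∸m⇒m+i<n m i<n∸m)

-- Finite sums: change of range, interchange, Kronecker delta.

module FiniteSums {c ℓ : Level} (R : CommutativeRing c ℓ) where
  open CommutativeRing R
  open Existence R using (Sm; Sm-0)
  open SemiringSum semiring using (sum-cong-≋; ∑-comm; *-distribˡ-sum)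

  Sm-cong-< : ∀ n {f g} → (∀ k → k < n → f k ≈ g k) → Sm n f ≈ Sm n g
  Sm-cong-< n h = sum-cong-≋ {n} λ i → h _ (toℕ<n i)

  Sm-zero : ∀ n {f} → (∀ k → k < n → f k ≈ 0#) → Sm n f ≈ 0#
  Sm-zero n h = trans (Sm-cong-< n h) (Sm-0 n)

  Sm-comm : ∀ m n (f : ℕ → ℕ → Carrier) →
    Sm m (λ i → Sm n (f i)) ≈ Sm n (λ j → Sm m (λ i → f i j))
  Sm-comm m n f = ∑-comm {m} {n} _

  *-distribˡ-Sm : ∀ n a f → a * Sm n f ≈ Sm n (λ k → a * f k)
  *-distribˡ-Sm n a f = *-distribˡ-sum {n} _ _

  -- Turns the range of `L`, which starts at `j`, into one starting at 0. For `j > n` the left side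
  -- is empty and every term on the right vanishes.
  Sm-lower : ∀ j n f → (∀ k → k < j → f k ≈ 0#) →
    Sm (n ∸ j) (λ i → f (j ℕ.+ i)) ≈ Sm n f
  Sm-lower zero    n       f h = refl
  Sm-lower (suc j) zero    f h = refl
  Sm-lower (suc j) (suc n) f h = trans
    (Sm-lower j n (λ k → f (suc k)) (λ k k<j → h (suc k) (s<s k<j)))
    (sym (trans (+-congʳ (h 0 z<s)) (+-identityˡ _)))

  Sm-upper : ∀ {m n} f → m ≤ n → (∀ k → m ≤ k → f k ≈ 0#) → Sm m f ≈ Sm n f
  Sm-upper {n = n} f z≤n h = sym (Sm-zero n (λ k _ → h k z≤n))
  Sm-upper f (s≤s m≤n) h =
    +-congˡ (Sm-upper (λ k → f (suc k)) m≤n (λ k m≤k → h (suc k) (s≤s m≤k)))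

  -- Structural recursion lets `δ (suc n) (suc m)` reduce to `δ n m`, the shift of both indices that
  -- the inductions below produce.
  δ : ℕ → ℕ → Carrier
  δ zero    zero    = 1#
  δ zero    (suc m) = 0#
  δ (suc n) zero    = 0#
  δ (suc n) (suc m) = δ n m

  Sm-δ : ∀ n {N} f → n < N → Sm N (λ m → f m * δ n m) ≈ f n
  Sm-δ zero {suc N} f _ =
    trans (+-cong (*-identityʳ _) (Sm-zero N (λ k _ → zeroʳ (f (suc k))))) (+-identityʳ _)
  Sm-δ (suc n) {suc N} f n<N = trans
    (+-cong (zeroʳ _) (Sm-δ n (λ m → f (suc m)) (s<s⁻¹ n<N))) (+-identityˡ _)

-- Uniqueness of coefficients in a unitriangular basis.

module Triangular {c ℓ : Level} (R : CommutativeRing c ℓ) where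
  open CommutativeRing R
  open Existence R using (Sm; Sm-last)
  open FiniteSums R
  open AbelianGroupProperties +-abelianGroup using (∙-cancelʳ)
  open SetoidReasoning setoid

  module _ (b : ℕ → ℕ → Carrier)
           (diagonal : ∀ k → b k k ≈ 1#)
           (above    : ∀ k i → k < i → b k i ≈ 0#) where

    top-coefficient : ∀ n (f : ℕ → Carrier) → Sm (suc n) (λ k → f k * b k n) ≈ f n
    top-coefficient n f = begin
      Sm (suc n) (λ k → f k * b k n)           ≈⟨ Sm-last n (λ k → f k * b k n) ⟩
      Sm n (λ k → f k * b k n) + f n * b n n
        ≈⟨ +-cong (Sm-zero n (λ k k<n → trans (*-congˡ (above k n k<n)) (zeroʳ (f k))))
                  (trans (*-congˡ (diagonal n)) (*-identityʳ _)) ⟩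
      0# + f n                                 ≈⟨ +-identityˡ _ ⟩
      f n                                      ∎

    -- Back substitution: column `n - 1` of the first `n` rows reads off the last coefficient. Its
    -- term is then cancelled in every column, leaving a system with one unknown fewer.
    coefficients-unique : ∀ n (f g : ℕ → Carrier) →
      (∀ i → Sm n (λ k → f k * b k i) ≈ Sm n (λ k → g k * b k i)) →
      ∀ k → k < n → f k ≈ g k
    coefficients-unique (suc n) f g h = go
      where
      fn≈gn : f n ≈ g n
      fn≈gn = trans (sym (top-coefficient n f)) (trans (h n) (top-coefficient n g))

      lower : ∀ i → Sm n (λ k → f k * b k i) ≈ Sm n (λ k → g k * b k i)
      lower i = ∙-cancelʳ (f n * b n i) _ _ (begin
        Sm n (λ k → f k * b k i) + f n * b n i  ≈⟨ Sm-last n (λ k → f k * b k i) ⟨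
        Sm (suc n) (λ k → f k * b k i)          ≈⟨ h i ⟩
        Sm (suc n) (λ k → g k * b k i)          ≈⟨ Sm-last n (λ k → g k * b k i) ⟩
        Sm n (λ k → g k * b k i) + g n * b n i  ≈⟨ +-congˡ (*-congʳ fn≈gn) ⟨
        Sm n (λ k → g k * b k i) + f n * b n i  ∎)

      go : ∀ k → k < suc n → f k ≈ g k
      go k k≤n with m<1+n⇒m<n∨m≡n k≤n
      ... | inj₁ k<n    = coefficients-unique n f g lower k k<n
      ... | inj₂ ≡.refl = fn≈gn

-- The recurrence for the Stirling numbers and the inverse relation.

module Recurrence {c ℓ : Level} (R : CommutativeRing c ℓ) where
  open CommutativeRing R
  open Over R
  open Existence R
  open FiniteSums R
  open Triangular R
  open RawMonoidDefs +-rawMonoid using (_×_)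
  open SemiringSolver commutativeSemiring
  open SetoidReasoning setoid

  module _ (α β γ : Carrier) where

    B-above : ∀ k i → k < i → coeff (B α β γ k) i ≈ 0#
    B-above zero    (suc i) _   = refl
    B-above (suc k) (suc i) k<i = begin
      coeff (B α β γ (suc k)) (suc i)    ≈⟨ mulLin (B α β γ k) _ (suc i) ⟩
      coeff (B α β γ k) (suc i) * _ + coeff (B α β γ k) i
        ≈⟨ +-cong (trans (*-congʳ (B-above k (suc i) (m<n⇒m<1+n (s<s⁻¹ k<i)))) (zeroˡ _))
                  (B-above k i (s<s⁻¹ k<i)) ⟩
      0# + 0#                            ≈⟨ +-identityˡ _ ⟩
      0#                                 ∎

    B-monic : ∀ k → coeff (B α β γ k) k ≈ 1#
    B-monic zero    = refl
    B-monic (suc k) = begin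
      coeff (B α β γ (suc k)) (suc k)    ≈⟨ mulLin (B α β γ k) _ (suc k) ⟩
      coeff (B α β γ k) (suc k) * _ + coeff (B α β γ k) k
        ≈⟨ +-cong (trans (*-congʳ (B-above k (suc k) ≤-refl)) (zeroˡ _)) (B-monic k) ⟩
      0# + 1#                            ≈⟨ +-identityˡ _ ⟩
      1#                                 ∎

    -- Both sides expand the same factorial of `indet` in the same monic basis. The bound `k ≤ n` is
    -- essential, since `S` is arbitrary beyond the diagonal.
    S≈T : (𝓢 : GeneralizedStirling) → ∀ n k → k ≤ n →
      GeneralizedStirling.S 𝓢 n k α β γ ≈ T α β γ n k
    S≈T 𝓢 n k k≤n = coefficients-unique (λ k → coeff (B α β γ k)) B-monic B-above
      (suc n) s (T α β γ n) same k (s≤s k≤n)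
      where
      s : ℕ → Carrier
      s k = GeneralizedStirling.S 𝓢 n k α β γ

      same : ∀ i → Sm (suc n) (λ k → s k * coeff (B α β γ k) i)
                 ≈ Sm (suc n) (λ k → T α β γ n k * coeff (B α β γ k) i)
      same i = begin
        Sm (suc n) (λ k → s k * coeff (B α β γ k) i)   ≈⟨ coeff-Σ (suc n) s (B α β γ) i ⟨
        _                                              ≈⟨ GeneralizedStirling.defining 𝓢 α β γ n i ⟨
        coeff (⟨ indet ∣ α ⟩ n) i                      ≈⟨ ex α β γ n i ⟩
        Sm (suc n) (λ k → T α β γ n k * coeff (B α β γ k) i)  ∎

    -- The transposed recurrence: summation by parts moves the step from row `n` to row `suc n` onto
    -- the sequence `b`, so that `b` can then be a column of `T²`.
    ΣT-suc : ∀ n (b : ℕ → Carrier) →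
      Sm (suc (suc n)) (λ k → T α β γ (suc n) k * b k)
        ≈ Sm (suc n) (λ k → T α β γ n k * (b (suc k) + e α β γ n k * b k))
    ΣT-suc n b = begin
      t 0 * ε 0 * b 0 + Sm (suc n) (λ k → (t k + t (suc k) * ε (suc k)) * b (suc k))
        ≈⟨ +-congˡ (Sm-cong (suc n) (λ k → distribʳ (b (suc k)) (t k) (t (suc k) * ε (suc k)))) ⟩
      g 0 + Sm (suc n) (λ k → t k * b (suc k) + g (suc k))
        ≈⟨ +-congˡ (Sm-+ (suc n) (λ k → t k * b (suc k)) (λ k → g (suc k))) ⟨
      g 0 + (Sm (suc n) (λ k → t k * b (suc k)) + Sm (suc n) (λ k → g (suc k)))
        ≈⟨ solve 3 (λ x y z → x :+ (y :+ z) := y :+ (x :+ z)) refl _ _ _ ⟩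
      Sm (suc n) (λ k → t k * b (suc k)) + Sm (suc (suc n)) g
        -- The extra term `g (suc n)` contains `T n (suc n)`, which lies above the diagonal.
        ≈⟨ +-congˡ (Sm-upper g (m<n⇒m<1+n ≤-refl) g-vanishes) ⟨
      Sm (suc n) (λ k → t k * b (suc k)) + Sm (suc n) g
        ≈⟨ Sm-+ (suc n) (λ k → t k * b (suc k)) g ⟩
      Sm (suc n) (λ k → t k * b (suc k) + g k)
        ≈⟨ Sm-cong (suc n) (λ k → solve 4 (λ x y z w → x :* y :+ x :* z :* w := x :* (y :+ z :* w))
             refl (t k) (b (suc k)) (ε k) (b k)) ⟩
      Sm (suc n) (λ k → t k * (b (suc k) + ε k * b k))  ∎
      where
      t ε g : ℕ → Carrier
      t = T α β γ n
      ε = e α β γ n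
      g k = t k * ε k * b k

      g-vanishes : ∀ k → n < k → g k ≈ 0#
      g-vanishes k n<k = trans (*-congʳ (trans (*-congʳ (T0 α β γ n k n<k)) (zeroˡ _))) (zeroˡ _)

    -- Since `γ` and `k × β` cancel, the result is free of the summation index `k` and can be pulled
    -- out of the sum over `k`.
    e²+e¹≈ : ∀ n k m → e β α (- γ) k m + e α β γ n k ≈ m × α - n × α
    e²+e¹≈ n k m = begin
      (- γ + x + - y) + (γ + y + z)
        ≈⟨ solve 6 (λ g g′ x y y′ z → (g′ :+ x :+ y′) :+ (g :+ y :+ z) := (g :+ g′) :+ ((y :+ y′) :+ (x :+ z)))
             refl γ (- γ) x y (- y) z ⟩
      (γ - γ) + ((y - y) + (x + z))
        ≈⟨ trans (+-cong (-‿inverseʳ γ) (+-congʳ (-‿inverseʳ y))) (trans (+-identityˡ _) (+-identityˡ _)) ⟩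
      x + z  ∎
      where
      x = m × α
      y = k × β
      z = - (n × α)

    δ-support : ∀ n m → δ n m * (m × α - n × α) ≈ 0#
    -- Multiples of `α` are generalised to any sequence `f`, because the recursion on `δ` shifts
    -- both indices and hence replaces `f` by its shift.
    δ-support n m = go n m (λ k → k × α)
      where
      go : ∀ n m (f : ℕ → Carrier) → δ n m * (f m - f n) ≈ 0#
      go zero    zero    f = trans (*-congˡ (-‿inverseʳ (f 0))) (zeroʳ _)
      go zero    (suc m) f = zeroˡ _
      go (suc n) zero    f = zeroˡ _
      go (suc n) (suc m) f = go n m (λ k → f (suc k))

    -- Induction on `n` for all columns at once: entry `(suc n , suc m)` becomes
    -- `δ n m + δ n (suc m) * d`, whose last term dies by `δ-support`. Column 0 is separate because
    -- the recurrence of `T²` has no left neighbour there.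
    T¹T²≈δ : ∀ n m → Sm (suc n) (λ k → T α β γ n k * T β α (- γ) k m) ≈ δ n m
    T¹T²≈δ zero zero    = trans (+-identityʳ _) (*-identityˡ _)
    T¹T²≈δ zero (suc m) = trans (+-identityʳ _) (*-identityˡ _)
    T¹T²≈δ (suc n) zero = begin
      Sm (suc (suc n)) (λ k → T α β γ (suc n) k * u k 0)
        ≈⟨ ΣT-suc n (λ k → u k 0) ⟩
      Sm (suc n) (λ k → t k * (u k 0 * e′ k + ε k * u k 0))
        ≈⟨ Sm-cong (suc n) (λ k → trans
             (solve 4 (λ t u e ε → t :* (u :* e :+ ε :* u) := t :* u :* (e :+ ε)) refl (t k) (u k 0) (e′ k) (ε k))
             (*-congˡ (e²+e¹≈ n k 0))) ⟩
      Sm (suc n) (λ k → t k * u k 0 * d)   ≈⟨ Sm-* (suc n) (λ k → t k * u k 0) d ⟨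
      Sm (suc n) (λ k → t k * u k 0) * d   ≈⟨ *-congʳ (T¹T²≈δ n 0) ⟩
      δ n 0 * d                            ≈⟨ δ-support n 0 ⟩
      0#                                   ∎
      where
      t ε e′ : ℕ → Carrier
      t = T α β γ n
      ε = e α β γ n
      e′ k = e β α (- γ) k 0
      u = T β α (- γ)
      d = 0 × α - n × α
    T¹T²≈δ (suc n) (suc m) = begin
      Sm (suc (suc n)) (λ k → T α β γ (suc n) k * u k (suc m))
        ≈⟨ ΣT-suc n (λ k → u k (suc m)) ⟩
      -- Here `u (suc k) (suc m)` has been unfolded by the recurrence of `T²`.
      Sm (suc n) (λ k → t k * (u k m + u k (suc m) * e′ k + ε k * u k (suc m)))
        ≈⟨ Sm-cong (suc n) (λ k → trans
             (solve 5 (λ t v u e ε → t :* (v :+ u :* e :+ ε :* u) := t :* v :+ t :* u :* (e :+ ε))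
               refl (t k) (u k m) (u k (suc m)) (e′ k) (ε k))
             (+-congˡ (*-congˡ (e²+e¹≈ n k (suc m))))) ⟩
      Sm (suc n) (λ k → t k * u k m + t k * u k (suc m) * d)
        ≈⟨ Sm-+ (suc n) (λ k → t k * u k m) (λ k → t k * u k (suc m) * d) ⟨
      Sm (suc n) (λ k → t k * u k m) + Sm (suc n) (λ k → t k * u k (suc m) * d)
        ≈⟨ +-congˡ (Sm-* (suc n) (λ k → t k * u k (suc m)) d) ⟨
      Sm (suc n) (λ k → t k * u k m) + Sm (suc n) (λ k → t k * u k (suc m)) * d
        ≈⟨ +-cong (T¹T²≈δ n m) (*-congʳ (T¹T²≈δ n (suc m))) ⟩
      δ n m + δ n (suc m) * d
        ≈⟨ +-congˡ (δ-support n (suc m)) ⟩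
      δ n m + 0#                           ≈⟨ +-identityʳ _ ⟩
      δ n m                                ∎
      where
      t ε e′ : ℕ → Carrier
      t = T α β γ n
      ε = e α β γ n
      e′ k = e β α (- γ) k (suc m)
      u = T β α (- γ)
      d = suc m × α - n × α

-- Row sums of the Lah-type matrix.

module RowSums {c ℓ : Level} (R : CommutativeRing c ℓ) where
  open CommutativeRing R
  open Over R
  open Existence R
  open FiniteSums R
  open Recurrence R
  open RingProperties ring using (-1*x≈-x; -‿involutive)
  open SemiringSolver commutativeSemiring
  open SetoidReasoning setoid

  sgn-square : ∀ n → sgn n * sgn n ≈ 1#
  sgn-square zero    = *-identityˡ 1#
  sgn-square (suc n) = begin
    (- 1# * sgn n) * (- 1# * sgn n)
      ≈⟨ solve 2 (λ x y → (x :* y) :* (x :* y) := (x :* x) :* (y :* y)) refl (- 1#) (sgn n) ⟩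
    (- 1# * - 1#) * (sgn n * sgn n)  ≈⟨ *-cong (trans (-1*x≈-x (- 1#)) (-‿involutive 1#)) (sgn-square n) ⟩
    1# * 1#                          ≈⟨ *-identityˡ 1# ⟩
    1#                               ∎

  module _ (𝓢 : GeneralizedStirling) (α β γ : Carrier) where
    open GeneralizedStirling 𝓢

    T¹ T² : ℕ → ℕ → Carrier
    T¹ = T α β γ
    T² = T β α (- γ)

    -- Triangularity of `T¹` fills in the terms below `j`, that of `T²` those above `k`. The range
    -- then depends on neither `j` nor `k`, so sums can be interchanged.
    L≈ΣT : ∀ {k N} j → k < N →
      L k j α β γ ≈ Sm N (λ m → sgn m * T² k m * T¹ m j)
    L≈ΣT {k} {N} j k<N = begin
      L k j α β γ
        -- Inside the range `j ≤ j + i ≤ k`, so both Stirling factors are in the region where `S` is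
        -- determined.
        ≈⟨ Sm-cong-< (suc k ∸ j) (λ i i< → *-cong
             (*-congˡ {sgn (j ℕ.+ i)} (S≈T β α (- γ) 𝓢 k (j ℕ.+ i) (s≤s⁻¹ (i<n∸m⇒m+i<n j i<))))
             (S≈T α β γ 𝓢 (j ℕ.+ i) j (m≤m+n j i))) ⟩
      Sm (suc k ∸ j) (λ i → g (j ℕ.+ i))
        ≈⟨ Sm-lower j (suc k) g (λ m m<j → trans (*-congˡ (T0 α β γ m j m<j)) (zeroʳ _)) ⟩
      Sm (suc k) g
        ≈⟨ Sm-upper g k<N (λ m k<m → trans
             (*-congʳ (trans (*-congˡ (T0 β α (- γ) k m k<m)) (zeroʳ _))) (zeroˡ _)) ⟩
      Sm N g  ∎
      where
      g : ℕ → Carrier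
      g m = sgn m * T² k m * T¹ m j

    module _ (n : ℕ) where
      N : ℕ
      N = suc n

      -- For `m < N` this is the full sum of row `m`, padded with zeros to a length independent of
      -- `m`.
      w : ℕ → Carrier
      w m = Sm N (T¹ m)

      ΣL≈ΣT : ∀ k → k < N → Sm N (λ j → L k j α β γ) ≈ Sm N (λ m → sgn m * T² k m * w m)
      ΣL≈ΣT k k<N = begin
        Sm N (λ j → L k j α β γ)
          ≈⟨ Sm-cong N (λ j → L≈ΣT j k<N) ⟩
        Sm N (λ j → Sm N (λ m → sgn m * T² k m * T¹ m j))
          ≈⟨ Sm-comm N N (λ j m → sgn m * T² k m * T¹ m j) ⟩
        Sm N (λ m → Sm N (λ j → sgn m * T² k m * T¹ m j))
          ≈⟨ Sm-cong N (λ m → *-distribˡ-Sm N (sgn m * T² k m) (T¹ m)) ⟨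
        Sm N (λ m → sgn m * T² k m * w m)  ∎

      ΣL*S≈ΣTT : ∀ k → k < N →
        sgn n * Sm N (λ j → L k j α β γ) * S n k α β γ
          ≈ Sm N (λ m → (sgn n * sgn m * w m) * (T¹ n k * T² k m))
      ΣL*S≈ΣTT k k<N = begin
        sgn n * Sm N (λ j → L k j α β γ) * S n k α β γ
          ≈⟨ *-cong (*-congˡ (ΣL≈ΣT k k<N)) (S≈T α β γ 𝓢 n k (s≤s⁻¹ k<N)) ⟩
        sgn n * Sm N (λ m → sgn m * T² k m * w m) * T¹ n k
          ≈⟨ solve 3 (λ x y z → x :* y :* z := (x :* z) :* y) refl _ _ _ ⟩
        (sgn n * T¹ n k) * Sm N (λ m → sgn m * T² k m * w m)
          ≈⟨ *-distribˡ-Sm N (sgn n * T¹ n k) (λ m → sgn m * T² k m * w m) ⟩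
        Sm N (λ m → (sgn n * T¹ n k) * (sgn m * T² k m * w m))
          ≈⟨ Sm-cong N (λ m → solve 5 (λ x t y u w → (x :* t) :* (y :* u :* w) := (x :* y :* w) :* (t :* u))
               refl (sgn n) (T¹ n k) (sgn m) (T² k m) (w m)) ⟩
        Sm N (λ m → (sgn n * sgn m * w m) * (T¹ n k * T² k m))  ∎

      ΣLS≈ΣS : Sm N (λ k → sgn n * Sm N (λ j → L k j α β γ) * S n k α β γ)
                ≈ Sm N (λ j → S n j α β γ)
      ΣLS≈ΣS = begin
        Sm N (λ k → sgn n * Sm N (λ j → L k j α β γ) * S n k α β γ)
          ≈⟨ Sm-cong-< N ΣL*S≈ΣTT ⟩
        Sm N (λ k → Sm N (λ m → (sgn n * sgn m * w m) * (T¹ n k * T² k m)))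
          -- With `k` innermost, the inner sum is an entry of the product of `T¹` and `T²`. Only
          -- `m = n` survives, where the two signs multiply to 1.
          ≈⟨ Sm-comm N N (λ k m → (sgn n * sgn m * w m) * (T¹ n k * T² k m)) ⟩
        Sm N (λ m → Sm N (λ k → (sgn n * sgn m * w m) * (T¹ n k * T² k m)))
          ≈⟨ Sm-cong N (λ m → *-distribˡ-Sm N (sgn n * sgn m * w m) (λ k → T¹ n k * T² k m)) ⟨
        Sm N (λ m → (sgn n * sgn m * w m) * Sm N (λ k → T¹ n k * T² k m))
          ≈⟨ Sm-cong N (λ m → *-congˡ {sgn n * sgn m * w m} (T¹T²≈δ α β γ n m)) ⟩
        Sm N (λ m → (sgn n * sgn m * w m) * δ n m)
          ≈⟨ Sm-δ n (λ m → sgn n * sgn m * w m) ≤-refl ⟩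
        sgn n * sgn n * w n
          ≈⟨ trans (*-congʳ (sgn-square n)) (*-identityˡ _) ⟩
        w n
          ≈⟨ Sm-cong-< N (λ j j<N → S≈T α β γ 𝓢 n j (s≤s⁻¹ j<N)) ⟨
        Sm N (λ j → S n j α β γ)  ∎

mainTheorem5 : {c ℓ : Level} (R : CommutativeRing c ℓ) →
  let open CommutativeRing R
      open Over R
  in
  (𝓢 : GeneralizedStirling) →
  let open GeneralizedStirling 𝓢 in
  (α β γ : Carrier) (n : ℕ) →
  let W = ∑[ j from 0 to n ] S n j α β γ in
  W ≈ (∑[ k from 0 to n ] sgn n * (∑[ j from 0 to n ] L k j α β γ) * S n k α β γ)
-- Sums from 0 to `n` unfold definitionally to `Sm (suc n)`.
mainTheorem5 R 𝓢 α β γ n = CommutativeRing.sym R (RowSums.ΣLS≈ΣS R 𝓢 α β γ n)
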